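{- The game of tic-tac-toe played on the affine plane of order $4$, $\pi_4$, is a first player win: the first player has a strategy that guarantees that he is the first to occupy all points of some line, regardless of how the second player plays.
   Context: An affine plane of order $n$ is a set of $n^2$ points together with $n(n+1)$ lines, each line a set of $n$ points, such that any two distinct points lie on exactly one common line; the lines partition into $n+1$ parallel classes, each partitioning the point set. The affine plane of order $4$, $\pi_4$ (16 points, 20 lines of 4 points each, 5 parallel classes), is unique up to isomorphism. Tic-tac-toe on $\pi_4$: two players alternately choose previously unchosen points, the first player moving first; a player wins as soon as he or she has chosen all points of some line; if all points are chosen without a win the game is a draw. -}

module Defs where

open import Data.Bool using (Bool; true; false)
open import Data.Product using (_×_; _,_; Σ; ∃)
open import Data.List using (List; []; _∷_)
open import Data.List.Membership.Propositional using (_∈_; _∉_)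
open import Relation.Binary.PropositionalEquality using (_≡_)
open import Relation.Nullary using (¬_)

-- The field GF(4) = {0, 1, ω, ω²} with ω² = ω + 1 (characteristic 2).
data F4 : Set where
  o i w w² : F4

_⊕_ : F4 → F4 → F4
o ⊕ y = y
x ⊕ o = x
i ⊕ i = o
i ⊕ w = w²
i ⊕ w² = w
w ⊕ i = w²
w ⊕ w = o
w ⊕ w² = i
w² ⊕ i = w
w² ⊕ w = i
w² ⊕ w² = o

_⊗_ : F4 → F4 → F4
o ⊗ y = o
x ⊗ o = o
i ⊗ y = y
x ⊗ i = x
w ⊗ w = w²
w ⊗ w² = i
w² ⊗ w = i
w² ⊗ w² = w

_==_ : F4 → F4 → Bool
o == o = true
i == i = true
w == w = true
w² == w² = true
_ == _ = false

Point : Set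
Point = F4 × F4

data Line : Set where
  slope : (m b : F4) → Line
  vert  : (c : F4) → Line

onLine : Point → Line → Bool
onLine (x , y) (slope m b) = y == ((m ⊗ x) ⊕ b)
onLine (x , y) (vert c) = x == c

Free : Point → List Point → List Point → Set
Free p xs ys = (p ∉ xs) × (p ∉ ys)

Occupies : List Point → Line → Set
Occupies zs L = ∀ p → onLine p L ≡ true → p ∈ zs

-- FirstWins xs ys : in the position where the first player has chosen the
-- points xs and the second player the points ys, with the first player to
-- move and nobody having won yet, the first player has a strategy that
-- forces him to be the first to occupy all points of some line.
data FirstWins (xs ys : List Point) : Set where
  winNow : (p : Point) → Free p xs ys → (L : Line) → Occupies (p ∷ xs) L →
           FirstWins xs ys
  move : (p : Point) → Free p xs ys →
         (Σ Point λ q → Free q (p ∷ xs) ys) →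
         (∀ q → Free q (p ∷ xs) ys →
            (∀ L → ¬ Occupies (q ∷ ys) L) × FirstWins (p ∷ xs) (q ∷ ys)) →
         FirstWins xs ys

FirstPlayerWinsπ₄ : Set
FirstPlayerWinsπ₄ = FirstWins [] []

{-# OPTIONS --safe #-}
-- The first player opens at the origin.  Linear maps act transitively on the
-- nonzero vectors, so up to symmetry the second player answers at (1 , 0), and
-- the first player continues at (0 , 1).  From there a few quiet moves lead to
-- chains of threats (three points on a line whose fourth point is free, to which
-- the reply is forced) ending in a double threat; that these defeat every reply
-- is verified by evaluation.
module Submission where

open import Defs
open import Data.Bool as Bool using (true)
open import Data.List using (List; []; _∷_; concatMap; mapMaybe; map)
open import Data.List.Membership.Propositional using (_∈_; _∉_)
open import Data.List.Membership.Propositional.Properties using (∈-map⁺; ∈-map⁻)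
open import Data.List.Relation.Unary.Any using (here; there)
open import Data.Maybe as Maybe using (Maybe; just; nothing; _<∣>_; _>>=_; from-just)
open import Data.Product using (_×_; _,_; ∃; proj₁; proj₂)
open import Data.Product.Properties using (≡-dec)
open import Data.Sum using (_⊎_; inj₁; inj₂)
open import Function using (const)
open import Relation.Binary.Definitions using (DecidableEquality)
open import Relation.Binary.PropositionalEquality using (_≡_; _≢_; refl; sym; trans; cong; subst; subst₂)
open import Relation.Nullary using (¬_; Dec; yes; no; contradiction)
open import Relation.Nullary.Decidable using (dec⇒maybe; ¬?; _×-dec_)
import Data.List.Membership.DecPropositional as DecMembership

-- Exhaustive search over GF(4), points and lines

infix 4 _≟_

_≟_ : DecidableEquality F4
o  ≟ o  = yes refl
o  ≟ i  = no λ ()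
o  ≟ w  = no λ ()
o  ≟ w² = no λ ()
i  ≟ o  = no λ ()
i  ≟ i  = yes refl
i  ≟ w  = no λ ()
i  ≟ w² = no λ ()
w  ≟ o  = no λ ()
w  ≟ i  = no λ ()
w  ≟ w  = yes refl
w  ≟ w² = no λ ()
w² ≟ o  = no λ ()
w² ≟ i  = no λ ()
w² ≟ w  = no λ ()
w² ≟ w² = yes refl

==⇒≡ : ∀ x y → (x == y) ≡ true → x ≡ y
==⇒≡ o  o  _ = refl
==⇒≡ i  i  _ = refl
==⇒≡ w  w  _ = refl
==⇒≡ w² w² _ = refl

==-refl : ∀ x → (x == x) ≡ true
==-refl o  = refl
==-refl i  = refl
==-refl w  = refl
==-refl w² = refl

_≟ₚ_ : DecidableEquality Point
_≟ₚ_ = ≡-dec _≟_ _≟_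

open DecMembership _≟ₚ_ using (_∈?_; _∉?_)

elements : List F4
elements = o ∷ i ∷ w ∷ w² ∷ []

-- A search yields a proof or `nothing`. Failure carries no refutation: `from-just` has the desired
-- type only if evaluation ends in `just`.
every : {P : F4 → Set} → (∀ x → Maybe (P x)) → Maybe (∀ x → P x)
every f = do
  po  ← f o
  pi  ← f i
  pw  ← f w
  pw² ← f w²
  just λ { o → po ; i → pi ; w → pw ; w² → pw² }

some : {P : F4 → Set} → (∀ x → Maybe (P x)) → Maybe (∃ P)
some {P} f = try o <∣> try i <∣> try w <∣> try w²
  where
  try : F4 → Maybe (∃ P)
  try x = Maybe.map (x ,_) (f x)

everyPoint : {P : Point → Set} → (∀ p → Maybe (P p)) → Maybe (∀ p → P p)
everyPoint f = Maybe.map (λ h (x , y) → h x y) (every λ x → every λ y → f (x , y))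

somePoint : {P : Point → Set} → (∀ p → Maybe (P p)) → Maybe (∃ P)
somePoint f = Maybe.map (λ (x , y , h) → (x , y) , h) (some λ x → some λ y → f (x , y))

everyLine : {P : Line → Set} → (∀ L → Maybe (P L)) → Maybe (∀ L → P L)
everyLine f = do
  slopes ← every λ m → every λ b → f (slope m b)
  verts  ← every λ c → f (vert c)
  just λ { (slope m b) → slopes m b ; (vert c) → verts c }

someLine : {P : Line → Set} → (∀ L → Maybe (P L)) → Maybe (∃ P)
someLine f =
  Maybe.map (λ (m , b , h) → slope m b , h) (some λ m → some λ b → f (slope m b))
  <∣> Maybe.map (λ (c , h) → vert c , h) (some λ c → f (vert c))

free? : ∀ p xs ys → Dec (Free p xs ys)
free? p xs ys = (p ∉? xs) ×-dec (p ∉? ys)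

-- Lines

-- Parametrises the points of a line by GF(4), so that a test on a line has 4 cases rather than 16.
at : Line → F4 → Point
at (slope m b) x = x , ((m ⊗ x) ⊕ b)
at (vert c)    y = c , y

at-onLine : ∀ L t → onLine (at L t) L ≡ true
at-onLine (slope m b) x = ==-refl ((m ⊗ x) ⊕ b)
at-onLine (vert c)    y = ==-refl c

onLine⇒at : ∀ p L → onLine p L ≡ true → ∃ λ t → p ≡ at L t
onLine⇒at (x , y) (slope m b) on = x , cong (x ,_) (==⇒≡ y _ on)
onLine⇒at (x , y) (vert c)    on = y , cong (_, y) (==⇒≡ x c on)

occupies? : ∀ zs L → Maybe (Occupies zs L)
occupies? zs L = Maybe.map covers (every λ t → dec⇒maybe (at L t ∈? zs))
  where
  covers : (∀ t → at L t ∈ zs) → Occupies zs L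
  covers all p on with onLine⇒at p L on
  ... | t , refl = all t

-- In characteristic 2 the intercept y − m x is y + m x.
linesThrough : Point → List Line
linesThrough (x , y) = vert x ∷ map (λ m → slope m (y ⊕ (m ⊗ x))) elements

-- Does not mention the second player's next point, so that one test per move of
-- the first player covers all replies.
Unfinishable : (xs ys : List Point) → Line → Set
Unfinishable xs ys L =
  ∃ λ t → at L t ∉ ys × (at L t ∈ xs ⊎ ∃ λ u → at L u ≢ at L t × at L u ∉ ys)

unfinishable? : ∀ xs ys L → Maybe (Unfinishable xs ys L)
unfinishable? xs ys L = some λ t → do
  t∉ys ← dec⇒maybe (at L t ∉? ys)
  rest ← Maybe.map inj₁ (dec⇒maybe (at L t ∈? xs))
         <∣> Maybe.map inj₂ (some λ u →
               dec⇒maybe (¬? (at L u ≟ₚ at L t) ×-dec (at L u ∉? ys)))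
  just (t∉ys , rest)

∈-∷⁻ : ∀ {p q : Point} {ys} → p ∈ q ∷ ys → p ∉ ys → p ≡ q
∈-∷⁻ (here p≡q)   _    = p≡q
∈-∷⁻ (there p∈ys) p∉ys = contradiction p∈ys p∉ys

-- The reply adds one point to `ys`, so each point of `L` missing from `ys` would have to be `q`;
-- but `q` avoids `xs` and cannot equal two distinct points.
unfinishable⇒¬occupies : ∀ {xs ys L q} → Unfinishable xs ys L → Free q xs ys →
                         ¬ Occupies (q ∷ ys) L
unfinishable⇒¬occupies {L = L} (t , t∉ys , inj₁ t∈xs) (q∉xs , _) occ
  with refl ← ∈-∷⁻ (occ _ (at-onLine L t)) t∉ys = q∉xs t∈xs
unfinishable⇒¬occupies {L = L} (t , t∉ys , inj₂ (u , u≢t , u∉ys)) _ occ =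
  u≢t (trans (∈-∷⁻ (occ _ (at-onLine L u)) u∉ys) (sym (∈-∷⁻ (occ _ (at-onLine L t)) t∉ys)))

-- Threats and replies

record Threat (xs ys : List Point) : Set where
  constructor threat
  field
    point     : Point
    free      : Free point xs ys
    line      : Line
    completed : Occupies (point ∷ xs) line

-- During a plan the lines through the latest move suffice: a threat that an earlier reply left open
-- has already been exploited.
threatsThrough : Point → ∀ xs ys → List (Threat xs ys)
threatsThrough p xs ys =
  concatMap (λ L → mapMaybe (λ t → threatAt L (at L t)) elements) (linesThrough p)
  where
  threatAt : Line → Point → Maybe (Threat xs ys)
  threatAt L r = do
    r-free ← dec⇒maybe (free? r xs ys)
    occ    ← occupies? (r ∷ xs) L
    just (threat r r-free L occ)

exploit : ∀ {xs ys} → List (Threat xs ys) → ∀ q → Maybe (FirstWins xs (q ∷ ys))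
exploit [] q = nothing
exploit (threat r (r∉xs , r∉ys) L occ ∷ ts) q with r ≟ₚ q
... | yes _  = exploit ts q
... | no r≢q = just (winNow r (r∉xs , λ r∈q∷ys → r≢q (∈-∷⁻ r∈q∷ys r∉ys)) L occ)

play : ∀ p xs ys → (∀ q → Maybe (FirstWins (p ∷ xs) (q ∷ ys))) → Maybe (FirstWins xs ys)
play p xs ys follow-up = do
  p-free ← dec⇒maybe (free? p xs ys)
  -- `move` asks for a free point, since on a full board its condition on replies would hold
  -- vacuously.
  reply  ← somePoint λ q → dec⇒maybe (free? q (p ∷ xs) ys)
  safe   ← everyLine (unfinishable? (p ∷ xs) ys)
  wins   ← everyPoint (answer (threatsThrough p (p ∷ xs) ys))
  just (move p p-free reply λ q q-free →
    (λ L → unfinishable⇒¬occupies (safe L) q-free) , wins q q-free)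
  where
  answer : List (Threat (p ∷ xs) ys) →
           ∀ q → Maybe (Free q (p ∷ xs) ys → FirstWins (p ∷ xs) (q ∷ ys))
  answer threats q with free? q (p ∷ xs) ys
  ... | yes _    = Maybe.map const (exploit threats q <∣> follow-up q)
  ... | no ¬free = just λ q-free → contradiction q-free ¬free

-- `p ▸ P` plays p, then completes a line if the reply permits it and follows P
-- otherwise; `P ∥ Q` falls back on Q where P fails, so that replies need not be
-- named.  `p !` ends a chain: every reply to p permits the completion of a line.
infixl 8 _!
infixr 7 _▸_
infixr 6 _∥_

data Plan : Set where
  _!  : Point → Plan
  _▸_ : Point → Plan → Plan
  _∥_ : Plan → Plan → Plan

execute : Plan → ∀ xs ys → Maybe (FirstWins xs ys)
execute (p !)   xs ys = play p xs ys λ _ → nothing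
execute (p ▸ P) xs ys = play p xs ys λ q → execute P (p ∷ xs) (q ∷ ys)
execute (P ∥ Q) xs ys = execute P xs ys <∣> execute Q xs ys

-- A = (0 , 0) and E = (1 , 0) are taken by the first two moves.
continuation : Plan
continuation =
  -- A, B and C lie on the line x = 0, so after C the reply D is forced if D is still free.
  B ▸ ( C ▸ ( K ▸ ( M ▸ (F ! ∥ P ▸ G ! ∥ L ▸ G !)
                  ∥ O ▸ (H ! ∥ J ▸ F !)
                  ∥ P ▸ (G ! ∥ I ▸ H !)
                  ∥ F ▸ (L ▸ N ! ∥ H ▸ J !)
                  ∥ G ▸ I ▸ N !
                  ∥ H ▸ O ! )
            ∥ N ▸ ( I ▸ (G ! ∥ L ▸ F ! ∥ P ▸ F !)
                  ∥ J ▸ (H ! ∥ O ▸ G !)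
                  ∥ L ▸ (F ! ∥ M ▸ H !)
                  ∥ F ▸ (M ▸ K ! ∥ G ▸ P !)
                  ∥ H ▸ O ▸ K !
                  ∥ G ▸ I ! ) )
      ∥ F ▸ ( J ▸ (H ▸ K ! ∥ D ▸ (O ! ∥ I ▸ (G ! ∥ K ! ∥ P !)) ∥ K ▸ M ▸ L !)
            ∥ N ▸ (C ▸ L ! ∥ P ▸ G !)
            ∥ K ▸ C ▸ (M ! ∥ L ▸ G !)
            ∥ D ▸ I ▸ P ! )
      ∥ J ▸ ( H ▸ (F ▸ K ! ∥ K ▸ (P ▸ L ! ∥ N ▸ L !))
            ∥ N ▸ G ▸ M ▸ P !
            ∥ F ▸ K ▸ O ▸ I !
            ∥ K ▸ (F ! ∥ I ▸ M ▸ G ! ∥ L ▸ N !)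
            ∥ M ▸ (H ! ∥ G ▸ (I ▸ L ! ∥ N ▸ O !)) )
      -- The plan for J reflected by the shear (x , y) ↦ (x , y + x + 1), which swaps A with B and
      -- fixes E.
      ∥ K ▸ ( H ▸ (F ▸ J ! ∥ J ▸ (N ▸ I ! ∥ P ▸ I !))
            ∥ P ▸ G ▸ O ▸ N !
            ∥ F ▸ J ▸ M ▸ L !
            ∥ J ▸ (F ! ∥ L ▸ O ▸ G ! ∥ I ▸ P !)
            ∥ O ▸ (H ! ∥ G ▸ (L ▸ I ! ∥ P ▸ M !)) )
      ∥ G ▸ ( C ▸ (I ▸ (N ! ∥ H ▸ K ! ∥ L ▸ K !) ∥ N ▸ (I ! ∥ H ▸ O !))
            ∥ D ▸ (J ▸ L ▸ H ! ∥ M ▸ P ▸ H !)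
            ∥ I ▸ H ▸ (N ! ∥ C ▸ K ! ∥ J ▸ K ! ∥ K ▸ O !)
            ∥ L ▸ H ▸ (P ! ∥ D ▸ J ! ∥ J ▸ M ! ∥ K ▸ I !) ) )
  where
  B = (o , i)
  C = (o , w)
  D = (o , w²)
  F = (i , i)
  G = (i , w)
  H = (i , w²)
  I = (w , o)
  J = (w , i)
  K = (w , w)
  L = (w , w²)
  M = (w² , o)
  N = (w² , i)
  O = (w² , w)
  P = (w² , w²)

-- Collineations

-- `image` finds M inside f(L), to carry over a winning line of the first player; `preimage` finds M
-- with f(M) inside L, to pull back a line occupied by the second.
record Collineation (f : Point → Point) : Set where
  field
    inverse  : ∀ p → ∃ λ q → f q ≡ p
    left-inv : ∀ p → proj₁ (inverse (f p)) ≡ p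
    image    : ∀ L → ∃ λ M → ∀ t → onLine (proj₁ (inverse (at M t))) L ≡ true
    preimage : ∀ L → ∃ λ M → ∀ t → onLine (f (at M t)) L ≡ true

collineation? : ∀ f → Maybe (Collineation f)
collineation? f = do
  inv   ← everyPoint λ p → somePoint λ q → dec⇒maybe (f q ≟ₚ p)
  left  ← everyPoint λ p → dec⇒maybe (proj₁ (inv (f p)) ≟ₚ p)
  im    ← everyLine λ L → someLine λ M → every λ t →
            dec⇒maybe (onLine (proj₁ (inv (at M t))) L Bool.≟ true)
  preim ← everyLine λ L → someLine λ M → every λ t →
            dec⇒maybe (onLine (f (at M t)) L Bool.≟ true)
  just record { inverse = inv ; left-inv = left ; image = im ; preimage = preim }

module _ {f : Point → Point} (coll : Collineation f) where
  open Collineation coll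

  f⁻¹ : Point → Point
  f⁻¹ p = proj₁ (inverse p)

  f∘f⁻¹ : ∀ p → f (f⁻¹ p) ≡ p
  f∘f⁻¹ p = proj₂ (inverse p)

  ∈-map-reflects : ∀ {p xs} → f p ∈ map f xs → p ∈ xs
  ∈-map-reflects {p} fp∈ with ∈-map⁻ f fp∈
  ... | q , q∈xs , fp≡fq =
    subst (_∈ _) (trans (sym (left-inv q)) (trans (cong f⁻¹ (sym fp≡fq)) (left-inv p))) q∈xs

  free-map⁺ : ∀ {p xs ys} → Free p xs ys → Free (f p) (map f xs) (map f ys)
  free-map⁺ (p∉xs , p∉ys) = (λ m → p∉xs (∈-map-reflects m)) , (λ m → p∉ys (∈-map-reflects m))

  free-map⁻ : ∀ {p xs ys} → Free (f p) (map f xs) (map f ys) → Free p xs ys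
  free-map⁻ (p∉xs , p∉ys) = (λ m → p∉xs (∈-map⁺ f m)) , (λ m → p∉ys (∈-map⁺ f m))

  occupies-map⁺ : ∀ {zs} L → Occupies zs L → Occupies (map f zs) (proj₁ (image L))
  occupies-map⁺ L occ p on with image L
  ... | M , M⊆fL with onLine⇒at p M on
  ... | t , refl = subst (_∈ _) (f∘f⁻¹ p) (∈-map⁺ f (occ _ (M⊆fL t)))

  occupies-map⁻ : ∀ {zs} L → Occupies (map f zs) L → Occupies zs (proj₁ (preimage L))
  occupies-map⁻ L occ p on with preimage L
  ... | M , fM⊆L with onLine⇒at p M on
  ... | t , refl = ∈-map-reflects (occ _ (fM⊆L t))

  -- The strategy is conjugated by `f`: a reply is pulled back along `f⁻¹`, answered in the original
  -- game, and the answer is pushed forward.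
  firstWins-map : ∀ {xs ys} → FirstWins xs ys → FirstWins (map f xs) (map f ys)
  firstWins-map (winNow p p-free L occ) =
    winNow (f p) (free-map⁺ p-free) (proj₁ (image L)) (occupies-map⁺ L occ)
  firstWins-map {xs} {ys} (move p p-free (q , q-free) next) =
    move (f p) (free-map⁺ p-free) (f q , free-map⁺ q-free) λ r →
      subst Answered (f∘f⁻¹ r) (answered (f⁻¹ r))
    where
    Answered : Point → Set
    Answered r = Free r (map f (p ∷ xs)) (map f ys) →
      (∀ L → ¬ Occupies (r ∷ map f ys) L) × FirstWins (map f (p ∷ xs)) (r ∷ map f ys)

    answered : ∀ r → Answered (f r)
    answered r r-free with next r (free-map⁻ r-free)
    ... | safe , wins = (λ L occ → safe (proj₁ (preimage L)) (occupies-map⁻ L occ)) , firstWins-map wins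

-- Linear, sends (1 , 0) to q, and is invertible unless q = (0 , 0).
frame : Point → Point → Point
frame (o , c) (x , y) = y , (c ⊗ x)
frame (a , c) (x , y) = (a ⊗ x) , ((c ⊗ x) ⊕ y)

firstWins-after-opening : FirstWins ((o , o) ∷ []) ((i , o) ∷ [])
firstWins-after-opening = from-just (execute continuation ((o , o) ∷ []) ((i , o) ∷ []))

-- For q = (0 , 0) the frame is singular and the result is `nothing`; this does no harm, as `play`
-- skips occupied points.
firstWins-from-frame : ∀ q → Maybe (FirstWins ((o , o) ∷ []) (q ∷ []))
firstWins-from-frame q = do
  coll  ← collineation? (frame q)
  fixes ← dec⇒maybe (frame q (o , o) ≟ₚ (o , o))
  sends ← dec⇒maybe (frame q (i , o) ≟ₚ q)
  just (subst₂ (λ a b → FirstWins (a ∷ []) (b ∷ [])) fixes sends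
          (firstWins-map coll firstWins-after-opening))

mainTheorem1 : FirstWins [] []
mainTheorem1 = from-just (play (o , o) [] [] firstWins-from-frame)
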